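{- Let $G=(V,w,m)$ be a locally finite weighted graph. For all $x,y\in V$ with $x\sim y$, $$K_1^{Ol}(x,y)\ge K_1(x,y).$$
   Context: A weighted graph $G=(V,w,m)$ consists of a vertex set $V$, symmetric edge weights $w:V\times V\to[0,\infty)$ and a vertex measure $m:V\to(0,\infty)$; $x\sim y$ (an edge, $x\neq y$) iff $w(x,y)>0$. Locally finite means every vertex has finitely many neighbors. Simple graphs are the case $w\in\{0,1\}$, $m\equiv1$. $d$ is the combinatorial (path) distance. $\Delta f(x)=\frac1{m(x)}\sum_y w(x,y)(f(y)-f(x))$, $|\nabla_1 f|(x)=\max_{d(x,y)\le 1}|f(y)-f(x)|$, $\|\nabla_1f\|_\infty=\sup_x|\nabla_1f|(x)$. Classical Ollivier curvature of an edge $x\sim y$: $$K_1^{Ol}(x,y)=\min\{\Delta f(x)-\Delta f(y)\;:\;f:V\to\mathbb{R},\ \|\nabla_1f\|_\infty=1,\ f(y)-f(x)=1\}.$$ Gradient-Ollivier curvature with $R=1$: $$K_1(x,y)=\inf\big\{\Delta|\nabla_1 f|(x)-(\Delta f(y)-\Delta f(x))\,\mathrm{sgn}(f(y)-f(x))\big\},$$ over all $f:V\to\mathbb{R}$ with $|\nabla_1f|(x)=1$ and $|f(y)-f(x)|=|\nabla_1 f|(x)$. -}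

module Defs where

open import Algebra.Bundles using (CommutativeRing)
open import Data.Bool.Base using (if_then_else_)
open import Data.List.Base using (List; []; _∷_; map; foldr)
open import Data.List.Membership.Propositional using (_∈_)
open import Data.List.Membership.Propositional.Properties using (∈-map⁺; ∈-map⁻)
import Data.List.Extrema
import Data.List.Relation.Unary.All as All
open import Data.List.Relation.Unary.Any using (here; there)
open import Data.List.Relation.Unary.Unique.Propositional using (Unique)
open import Data.Nat.Base as ℕ using (ℕ; zero; suc; z≤n; s≤s)
open import Data.Product.Base using (∃; ∃-syntax; _×_; _,_)
open import Data.Sum.Base using (inj₁; inj₂)
open import Function.Bundles using (_⇔_; mk⇔; Equivalence)
open import Level using (0ℓ) renaming (suc to lsuc)
open import Relation.Binary.Bundles using (TotalOrder; DecTotalOrder)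
open import Relation.Binary.Core using (Rel)
import Relation.Binary.Construct.Add.Extrema.NonStrict as ExtendedOrder
open import Relation.Binary.PropositionalEquality.Core as ≡ using (_≡_; _≢_)
open import Relation.Binary.Structures using (IsDecTotalOrder)
open import Relation.Nullary.Construct.Add.Extrema using (_±; [_])
open import Relation.Nullary.Decidable.Core using (does)
open import Relation.Nullary.Negation.Core using (¬_)
open import Relation.Unary using (Pred)

module _ {A : Set} (_≤_ : Rel A 0ℓ) where

  UpperBound : Pred A 0ℓ → Pred A 0ℓ
  UpperBound S b = ∀ {a} → S a → a ≤ b

  LowerBound : Pred A 0ℓ → Pred A 0ℓ
  LowerBound S b = ∀ {a} → S a → b ≤ a

  IsSupremum : Pred A 0ℓ → Pred A 0ℓ
  IsSupremum S s = UpperBound S s × LowerBound (UpperBound S) s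

  IsInfimum : Pred A 0ℓ → Pred A 0ℓ
  IsInfimum S s = LowerBound S s × UpperBound (LowerBound S) s

  IsMaximum : Pred A 0ℓ → Pred A 0ℓ
  IsMaximum S s = S s × UpperBound S s

  IsMinimum : Pred A 0ℓ → Pred A 0ℓ
  IsMinimum S s = S s × LowerBound S s

-- The real numbers, axiomatised as a Dedekind-complete ordered field.  As in
-- classical mathematics the order is decidable, which makes max and sgn total
-- functions.
record CompleteOrderedField : Set (lsuc 0ℓ) where
  infix 4 _≤_ _<_
  infix 8 _⁻¹
  field
    commutativeRing : CommutativeRing 0ℓ 0ℓ

  open CommutativeRing commutativeRing public
    hiding (_≉_; zero)

  field
    _≤_             : Rel Carrier 0ℓ
    isDecTotalOrder : IsDecTotalOrder _≈_ _≤_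
    +-monoʳ-≤       : ∀ x {y z} → y ≤ z → x + y ≤ x + z
    *-nonNegative   : ∀ {x y} → 0# ≤ x → 0# ≤ y → 0# ≤ x * y
    0≉1             : ¬ 0# ≈ 1#
    -- Only its values at nonzero arguments are specified.
    _⁻¹             : Carrier → Carrier
    ⁻¹-inverseʳ     : ∀ {x} → ¬ x ≈ 0# → x * x ⁻¹ ≈ 1#
    complete        : (S : Pred Carrier 0ℓ) → ∃ S → ∃ (UpperBound _≤_ S) →
                      ∃ (IsSupremum _≤_ S)

  open IsDecTotalOrder isDecTotalOrder public using (_≟_; _≤?_)

  decTotalOrder : DecTotalOrder 0ℓ 0ℓ 0ℓ
  decTotalOrder = record { isDecTotalOrder = isDecTotalOrder }

  totalOrder : TotalOrder 0ℓ 0ℓ 0ℓ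
  totalOrder = DecTotalOrder.totalOrder decTotalOrder

  open Data.List.Extrema totalOrder public using (max)
  open ExtendedOrder _≤_ public using (_≤±_)

  _<_ : Rel Carrier 0ℓ
  x < y = x ≤ y × ¬ x ≈ y

  ∣_∣ : Carrier → Carrier
  ∣ x ∣ = max x (- x ∷ [])

  sgn : Carrier → Carrier
  sgn x = if does (x ≟ 0#) then 0# else if does (0# ≤? x) then 1# else - 1#

  sum : List Carrier → Carrier
  sum = foldr _+_ 0#

  -- The infimum of a set of reals, taken in [-∞, +∞].
  IsInfimum± : Pred Carrier 0ℓ → Pred (Carrier ±) 0ℓ
  IsInfimum± S = IsInfimum _≤±_ (λ κ → ∃[ t ] S t × κ ≡ [ t ])

module _ (ℝ : CompleteOrderedField) where
  open CompleteOrderedField ℝ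

  -- Nothing is required of the diagonal of w; it does not affect adjacency or Δ.
  record WeightedGraph : Set (lsuc 0ℓ) where
    infix 4 _∼_
    field
      V           : Set
      w           : V → V → Carrier
      m           : V → Carrier
      w-symmetric : ∀ x y → w x y ≈ w y x
      w-nonNeg    : ∀ x y → 0# ≤ w x y
      m-positive  : ∀ x → 0# < m x

    _∼_ : Rel V 0ℓ
    x ∼ y = x ≢ y × 0# < w x y

    data Walk : V → V → ℕ → Set where
      []  : ∀ {x} → Walk x x zero
      _∷_ : ∀ {x y z n} → x ∼ y → Walk y z n → Walk x z (suc n)

    -- d(x,y) ≤ n, for the path distance d, which is infinite between components.
    d[_,_]≤_ : V → V → ℕ → Set
    d[ x , y ]≤ n = ∃[ k ] k ℕ.≤ n × Walk x y k

  record LocallyFinite (G : WeightedGraph) : Set where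
    open WeightedGraph G
    field
      neighbours        : V → List V
      neighbours-unique : ∀ x → Unique (neighbours x)
      ∈-neighbours      : ∀ {x y} → y ∈ neighbours x ⇔ x ∼ y

module Curvature (ℝ : CompleteOrderedField) (G : WeightedGraph ℝ)
                 (locallyFinite : LocallyFinite ℝ G) where
  open CompleteOrderedField ℝ
  open WeightedGraph G public
  open LocallyFinite locallyFinite public

  Δ : (V → Carrier) → V → Carrier
  Δ f x = m x ⁻¹ * sum (map (λ y → w x y * (f y - f x)) (neighbours x))

  -- The unit ball about x is {x} ∪ neighbours x; see ∣∇₁∣-isMaximum.
  ∣∇₁_∣ : (V → Carrier) → V → Carrier
  ∣∇₁ f ∣ x = max (∣ f x - f x ∣) (map (λ y → ∣ f y - f x ∣) (neighbours x))

  ∣∇₁∣-isMaximum : ∀ f x →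
    IsMaximum _≤_ (λ t → ∃[ y ] d[ x , y ]≤ 1 × t ≈ ∣ f y - f x ∣) (∣∇₁ f ∣ x)
  ∣∇₁∣-isMaximum f x = attained , bound
    where
    module ≤ = DecTotalOrder decTotalOrder
    open Data.List.Extrema totalOrder using (argmax-sel; ⊥≤max; xs≤max)
    g : V → Carrier
    g y = ∣ f y - f x ∣

    attained : ∃[ y ] d[ x , y ]≤ 1 × ∣∇₁ f ∣ x ≈ g y
    attained with argmax-sel (λ t → t) (g x) (map g (neighbours x))
    ... | inj₁ eq = x , (0 , z≤n , []) , ≤.Eq.reflexive eq
    ... | inj₂ t∈ with ∈-map⁻ g t∈
    ...   | y , y∈ , eq =
            y , (1 , s≤s z≤n , Equivalence.to ∈-neighbours y∈ ∷ []) , ≤.Eq.reflexive eq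

    bound : ∀ {t} → ∃[ y ] d[ x , y ]≤ 1 × t ≈ g y → t ≤ ∣∇₁ f ∣ x
    bound (_ , (0 , _ , []) , t≈) =
      ≤.trans (≤.reflexive t≈) (⊥≤max (g x) (map g (neighbours x)))
    bound (_ , (1 , _ , x∼y ∷ []) , t≈) =
      ≤.trans (≤.reflexive t≈)
        (All.lookup (xs≤max (g x) (map g (neighbours x)))
          (∈-map⁺ g (Equivalence.from ∈-neighbours x∼y)))
    bound (_ , (suc (suc _) , s≤s () , _) , _)

  ‖∇₁_‖∞≈_ : (V → Carrier) → Carrier → Set
  ‖∇₁ f ‖∞≈ c = IsSupremum _≤_ (λ t → ∃[ x ] t ≈ ∣∇₁ f ∣ x) c

  OllivierValues : V → V → Pred Carrier 0ℓ
  OllivierValues x y t = ∃[ f ]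
    ‖∇₁ f ‖∞≈ 1# × f y - f x ≈ 1# × t ≈ Δ f x - Δ f y

  GradientValues : V → V → Pred Carrier 0ℓ
  GradientValues x y t = ∃[ f ]
    ∣∇₁ f ∣ x ≈ 1# × ∣ f y - f x ∣ ≈ ∣∇₁ f ∣ x ×
    t ≈ Δ ∣∇₁ f ∣ x - (Δ f y - Δ f x) * sgn (f y - f x)

  IsK₁ᴼˡ : V → V → Pred Carrier 0ℓ
  IsK₁ᴼˡ x y = IsMinimum _≤_ (OllivierValues x y)

  -- Extended-real: Δ f y is not controlled by the constraints at x, so the
  -- infimum may be -∞.
  IsK₁ : V → V → Pred (Carrier ±) 0ℓ
  IsK₁ x y = IsInfimum± (GradientValues x y)

{-# OPTIONS --safe #-}
-- A function f attaining the Ollivier minimum is 1-Lipschitz with f y - f x = 1, so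
-- |∇₁ f| attains its maximum 1 at x.  Hence f is admissible for K₁, and
-- Δ|∇₁ f|(x) ≤ 0 bounds its gradient value by its Ollivier value.
module Submission where

open import Defs
open import Data.List.Base using ([]; _∷_; map)
import Data.List.Extrema
open import Data.Nat.Base using (z≤n; s≤s)
open import Data.Product.Base using (_,_; proj₁; proj₂)
open import Data.Sum.Base using (inj₁; inj₂)
open import Relation.Binary.Bundles using (DecTotalOrder)
import Relation.Binary.Construct.Add.Extrema.NonStrict as ExtendedOrder
import Relation.Binary.PropositionalEquality.Core as ≡
import Relation.Binary.Reasoning.PartialOrder
open import Relation.Nullary.Construct.Add.Extrema using (_±; [_])
open import Relation.Nullary.Decidable.Core using (yes; no)
open import Relation.Nullary.Negation.Core using (contradiction)

module OrderedField (ℝ : CompleteOrderedField) where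
  open CompleteOrderedField ℝ
  open import Algebra.Properties.Ring ring using (-‿distribʳ-*; -‿involutive; -1*x≈-x)
  module ≤ = DecTotalOrder decTotalOrder
  open Relation.Binary.Reasoning.PartialOrder ≤.poset

  x≤0⇒0≤-x : ∀ {x} → x ≤ 0# → 0# ≤ - x
  x≤0⇒0≤-x {x} x≤0 = begin
    0#        ≈⟨ -‿inverseˡ x ⟨
    - x + x   ≤⟨ +-monoʳ-≤ (- x) x≤0 ⟩
    - x + 0#  ≈⟨ +-identityʳ (- x) ⟩
    - x       ∎

  0≤-x⇒x≤0 : ∀ {x} → 0# ≤ - x → x ≤ 0#
  0≤-x⇒x≤0 {x} 0≤-x = begin
    x         ≈⟨ +-identityʳ x ⟨
    x + 0#    ≤⟨ +-monoʳ-≤ x 0≤-x ⟩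
    x + - x   ≈⟨ -‿inverseʳ x ⟩
    0#        ∎

  +-monoˡ-≤ : ∀ z {x y} → x ≤ y → x + z ≤ y + z
  +-monoˡ-≤ z {x} {y} x≤y = begin
    x + z  ≈⟨ +-comm x z ⟩
    z + x  ≤⟨ +-monoʳ-≤ z x≤y ⟩
    z + y  ≈⟨ +-comm z y ⟩
    y + z  ∎

  x≤y⇒x-y≤0 : ∀ {x y} → x ≤ y → x - y ≤ 0#
  x≤y⇒x-y≤0 {x} {y} x≤y = begin
    x - y  ≤⟨ +-monoˡ-≤ (- y) x≤y ⟩
    y - y  ≈⟨ -‿inverseʳ y ⟩
    0#     ∎

  *-nonNeg-nonPos : ∀ {x y} → 0# ≤ x → y ≤ 0# → x * y ≤ 0#
  *-nonNeg-nonPos {x} {y} 0≤x y≤0 = 0≤-x⇒x≤0 (begin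
    0#         ≤⟨ *-nonNegative 0≤x (x≤0⇒0≤-x y≤0) ⟩
    x * - y    ≈⟨ -‿distribʳ-* x y ⟨
    - (x * y)  ∎)

  -- The order axioms do not fix the sign of `1#`. Were it nonpositive, `- 1#` would be nonnegative,
  -- and so would its square, which is `1#`.
  0≤1 : 0# ≤ 1#
  0≤1 with ≤.total 0# 1#
  ... | inj₁ 0≤1 = 0≤1
  ... | inj₂ 1≤0 = begin
    0#           ≤⟨ *-nonNegative (x≤0⇒0≤-x 1≤0) (x≤0⇒0≤-x 1≤0) ⟩
    - 1# * - 1#  ≈⟨ -1*x≈-x (- 1#) ⟩
    - - 1#       ≈⟨ -‿involutive 1# ⟩
    1#           ∎

  -- A nonpositive inverse would make the product `x * x ⁻¹ ≈ 1#` nonpositive, forcing `0# ≈ 1#`.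
  x>0⇒x⁻¹≥0 : ∀ {x} → 0# < x → 0# ≤ x ⁻¹
  x>0⇒x⁻¹≥0 {x} (0≤x , 0≉x) with ≤.total 0# (x ⁻¹)
  ... | inj₁ 0≤x⁻¹ = 0≤x⁻¹
  ... | inj₂ x⁻¹≤0 = contradiction (≤.antisym 0≤1 1≤0) 0≉1
    where
    1≤0 : 1# ≤ 0#
    1≤0 = begin
      1#        ≈⟨ ⁻¹-inverseʳ (λ x≈0 → 0≉x (sym x≈0)) ⟨
      x * x ⁻¹  ≤⟨ *-nonNeg-nonPos 0≤x x⁻¹≤0 ⟩
      0#        ∎

  x≤∣x∣ : ∀ x → x ≤ ∣ x ∣
  -- In `∣ x ∣` the argument `x` itself is the default value of `max`, which `⊥≤max` bounds.
  x≤∣x∣ x = ⊥≤max x (- x ∷ [])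
    where open Data.List.Extrema totalOrder using (⊥≤max)

  sgn≈1 : ∀ {x} → x ≈ 1# → sgn x ≈ 1#
  sgn≈1 {x} x≈1 with x ≟ 0#
  ... | yes x≈0 = contradiction (trans (sym x≈0) x≈1) 0≉1
  ... | no  _ with 0# ≤? x
  ...   | yes _   = refl
  ...   | no  0≰x = contradiction (≤.trans 0≤1 (≤.reflexive (sym x≈1))) 0≰x

  sum-nonPos : ∀ {A : Set} (h : A → Carrier) → (∀ a → h a ≤ 0#) →
               ∀ as → sum (map h as) ≤ 0#
  sum-nonPos h h≤0 []       = ≤.refl
  sum-nonPos h h≤0 (a ∷ as) = begin
    h a + sum (map h as)  ≤⟨ +-monoʳ-≤ (h a) (sum-nonPos h h≤0 as) ⟩
    h a + 0#              ≈⟨ +-identityʳ (h a) ⟩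
    h a                   ≤⟨ h≤0 a ⟩
    0#                    ∎

module CurvatureProperties (ℝ : CompleteOrderedField) (G : WeightedGraph ℝ)
                           (locallyFinite : LocallyFinite ℝ G) where
  open CompleteOrderedField ℝ
  open Curvature ℝ G locallyFinite
  open OrderedField ℝ
  open import Algebra.Properties.AbelianGroup +-abelianGroup
    using (⁻¹-anti-homo‿-)
  open Relation.Binary.Reasoning.PartialOrder ≤.poset

  -- Maximum principle: at a maximum each difference `g z - g x` is nonpositive, while the weights
  -- and `m x ⁻¹` are nonnegative.
  Δ-nonPos-at-maximum : ∀ g {x} → (∀ z → g z ≤ g x) → Δ g x ≤ 0#
  Δ-nonPos-at-maximum g {x} g≤gx =
    *-nonNeg-nonPos (x>0⇒x⁻¹≥0 (m-positive x))
      (sum-nonPos _ (λ z → *-nonNeg-nonPos (w-nonNeg x z) (x≤y⇒x-y≤0 (g≤gx z)))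
        (neighbours x))

  ∣fy-fx∣≤∣∇₁∣ : ∀ f {x y} → x ∼ y → ∣ f y - f x ∣ ≤ ∣∇₁ f ∣ x
  ∣fy-fx∣≤∣∇₁∣ f {x} {y} x∼y =
    -- The edge is a walk of length one, so `y` lies in the unit ball about `x`.
    proj₂ (∣∇₁∣-isMaximum f x) (y , (1 , s≤s z≤n , x∼y ∷ []) , refl)

  module _ f {x y} (x∼y : x ∼ y) (‖∇f‖≈1 : ‖∇₁ f ‖∞≈ 1#) (fy-fx≈1 : f y - f x ≈ 1#) where

    ∣∇₁∣≤1 : ∀ z → ∣∇₁ f ∣ z ≤ 1#
    ∣∇₁∣≤1 z = proj₁ ‖∇f‖≈1 (z , refl)

    1≤∣fy-fx∣ : 1# ≤ ∣ f y - f x ∣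
    1≤∣fy-fx∣ = ≤.trans (≤.reflexive (sym fy-fx≈1)) (x≤∣x∣ (f y - f x))

    1≤∣∇₁∣ : 1# ≤ ∣∇₁ f ∣ x
    1≤∣∇₁∣ = ≤.trans 1≤∣fy-fx∣ (∣fy-fx∣≤∣∇₁∣ f x∼y)

    gradientValue : Carrier
    gradientValue = Δ ∣∇₁ f ∣ x - (Δ f y - Δ f x) * sgn (f y - f x)

    -- Both equalities come from closing up the chain `1# ≤ ∣ f y - f x ∣ ≤ ∣∇₁ f ∣ x ≤ 1#`, whose
    -- last bound is the Lipschitz condition.
    gradientValue∈GradientValues : GradientValues x y gradientValue
    gradientValue∈GradientValues =
      f , ≤.antisym (∣∇₁∣≤1 x) 1≤∣∇₁∣
        , ≤.antisym (∣fy-fx∣≤∣∇₁∣ f x∼y) (≤.trans (∣∇₁∣≤1 x) 1≤∣fy-fx∣)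
        , refl

    -- Since the sign factor is `1#`, the two values differ exactly by `Δ ∣∇₁ f ∣ x`, which the
    -- maximum principle makes nonpositive.
    gradientValue≤ollivierValue : gradientValue ≤ Δ f x - Δ f y
    gradientValue≤ollivierValue = begin
      Δ ∣∇₁ f ∣ x - (Δ f y - Δ f x) * sgn (f y - f x)
        ≤⟨ +-monoˡ-≤ _ (Δ-nonPos-at-maximum ∣∇₁ f ∣ (λ z → ≤.trans (∣∇₁∣≤1 z) 1≤∣∇₁∣)) ⟩
      0# - (Δ f y - Δ f x) * sgn (f y - f x)
        ≈⟨ +-identityˡ _ ⟩
      - ((Δ f y - Δ f x) * sgn (f y - f x))
        ≈⟨ -‿cong (trans (*-congˡ (sgn≈1 fy-fx≈1)) (*-identityʳ _)) ⟩
      - (Δ f y - Δ f x)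
        ≈⟨ ⁻¹-anti-homo‿- (Δ f y) (Δ f x) ⟩
      Δ f x - Δ f y
        ∎

theorem1p3 : (ℝ : CompleteOrderedField) (G : WeightedGraph ℝ) (locallyFinite : LocallyFinite ℝ G) →
    let open CompleteOrderedField ℝ
        open Curvature ℝ G locallyFinite
    in (x y : V) → x ∼ y →
       (kᴼˡ : Carrier) → IsK₁ᴼˡ x y kᴼˡ →
       (k : Carrier ±) → IsK₁ x y k →
       k ≤± [ kᴼˡ ]
theorem1p3 ℝ G locallyFinite x y x∼y kᴼˡ
  ((f , ‖∇f‖≈1 , fy-fx≈1 , kᴼˡ≈) , _) k (k-lowerBound , _) =
  -- The chain in the extended reals is `k ≤± [ gradientValue ] ≤± [ kᴼˡ ]`. Its first link holds
  -- even when `k` is infinite, and its second is an inequality of reals.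
  ≤±-trans ≤.trans
    (k-lowerBound (_ , gradientValue∈GradientValues f x∼y ‖∇f‖≈1 fy-fx≈1 , ≡.refl))
    [ ≤.trans (gradientValue≤ollivierValue f x∼y ‖∇f‖≈1 fy-fx≈1)
              (≤.reflexive (sym kᴼˡ≈)) ]
  where
  open CompleteOrderedField ℝ
  open OrderedField ℝ
  open CurvatureProperties ℝ G locallyFinite
  open ExtendedOrder _≤_ using (≤±-trans; [_])
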